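{- Let $G$ be a group of order $v$. If an $n$-dimensional $(v,k,\lambda)$ difference set $D\subseteq G^n$ exists, then $n\le v$.
   Context: Groups are written additively but are not necessarily abelian. A $(v,k,\lambda)$ difference set in a group $G$ of order $v$ is a $k$-subset $D\subseteq G$ such that every $g\in G\setminus\{0\}$ can be written as $g=a-b$ with $a,b\in D$ in exactly $\lambda$ ways. An $n$-dimensional $(v,k,\lambda)$ difference set in $G$ is a $k$-subset $D\subseteq G^n$ of $n$-tuples such that for every pair of coordinates $1\le x<y\le n$ the set $\{d_x-d_y\mid d\in D\}$ is a $(v,k,\lambda)$ difference set in $G$.
   Formalization: The formal theorem assumes k ≥ 2; for k ≤ 1 the claim is false as stated, since D = {(0,…,0)} is an n-dimensional (v,1,0) difference set, and D = ∅ an n-dimensional (v,0,0) one, for every n. -}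

module Defs where

open import Algebra.Bundles using (Group)
open import Data.Fin.Base as Fin using (Fin)
open import Data.Nat.Base using (ℕ)
open import Data.Product.Base using (_×_; _,_; proj₁; ∃-syntax)
open import Data.Product.Relation.Binary.Pointwise.NonDependent using (_×ₛ_)
open import Data.Vec.Functional using (Vector)
import Data.Vec.Functional.Relation.Binary.Equality.Setoid as VecEq
open import Function.Bundles using (Bijection)
open import Level using (Level; _⊔_)
open import Relation.Binary.Bundles using (Setoid)
import Relation.Binary.Construct.On as On
open import Relation.Binary.Definitions using (_Respects_)
open import Relation.Binary.PropositionalEquality.Properties as ≡ using ()
open import Relation.Nullary.Negation using (¬_)
open import Relation.Unary using (Pred; _∈_)

private
  variable
    c ℓ p : Level

-- Elements are counted up to the setoid equality.
HasSize : Setoid c ℓ → ℕ → Set (c ⊔ ℓ)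
HasSize S n = Bijection (≡.setoid (Fin n)) S

-- Membership proofs are ignored by the equality, so every element of S
-- satisfying P counts once, however many proofs of P it has.
restrict : (S : Setoid c ℓ) → Pred (Setoid.Carrier S) p → Setoid (c ⊔ p) ℓ
restrict S P = On.setoid S (proj₁ {B = P})

record IsSubsetOfSize (S : Setoid c ℓ) (k : ℕ) (D : Pred (Setoid.Carrier S) p)
                      : Set (c ⊔ ℓ ⊔ p) where
  open Setoid S
  field
    respects : D Respects _≈_
    size     : HasSize (restrict S D) k

-- The group operation, written _∙_ in the library, is thought of additively:
-- ε is 0 and a - b is a ∙ b ⁻¹.  It is not assumed commutative.
module _ (G : Group c ℓ) where
  open Group G using (Carrier; _≈_; setoid; ε; _-_)

  representations : Pred Carrier p → Carrier → Pred (Carrier × Carrier) (ℓ ⊔ p)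
  representations D g (a , b) = a ∈ D × b ∈ D × g ≈ a - b

  record IsDifferenceSet (v k lam : ℕ) (D : Pred Carrier p)
                         : Set (c ⊔ ℓ ⊔ p) where
    field
      order       : HasSize setoid v
      subset      : IsSubsetOfSize setoid k D
      differences : ∀ g → ¬ (g ≈ ε) →
                    HasSize (restrict (setoid ×ₛ setoid) (representations D g)) lam

  coordinateDifferences : ∀ {n} → Pred (Vector Carrier n) p →
                          Fin n → Fin n → Pred Carrier (c ⊔ ℓ ⊔ p)
  coordinateDifferences D x y g = ∃[ d ] d ∈ D × g ≈ d x - d y

  record IsMultiDifferenceSet (n v k lam : ℕ) (D : Pred (Vector Carrier n) p)
                              : Set (c ⊔ ℓ ⊔ p) where
    field
      order       : HasSize setoid v
      subset      : IsSubsetOfSize (VecEq.≋-setoid setoid n) k D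
      differences : ∀ x y → x Fin.< y →
                    IsDifferenceSet v k lam (coordinateDifferences D x y)

{-# OPTIONS --safe #-}

-- For x < y the map d ↦ d x - d y sends the k-set D onto a k-set, so it is
-- injective on D.  Take two distinct tuples a, b of D.  An equality
-- (- b x) + a x = (- b y) + a y would give a x - a y = b x - b y, so the map
-- x ↦ (- b x) + a x embeds the n coordinates into G.

module Submission where

open import Defs
open import Algebra.Bundles using (Group)
import Algebra.Properties.Group as GroupProperties
open import Data.Fin.Base as Fin using (Fin; zero; suc; punchOut)
open import Data.Fin.Properties using (_≟_; any?; <-cmp; injective⇒≤; punchOut-injective)
open import Data.Nat.Base using (ℕ; _≤_; s≤s)
open import Data.Nat.Properties using (1+n≰n)
open import Data.Product.Base using (Σ-syntax; _,_; proj₁; proj₂)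
open import Data.Vec.Functional using (Vector)
open import Function.Base using (_∘_)
open import Function.Bundles using (Bijection; Inverse)
open import Function.Definitions using (Injective; StrictlySurjective)
open import Function.Properties.Bijection using (Bijection⇒Inverse)
open import Level using (Level)
open import Relation.Binary.Bundles using (Setoid)
open import Relation.Binary.Definitions using (tri<; tri≈; tri>)
open import Relation.Binary.PropositionalEquality.Core as ≡ using (_≡_; _≢_)
import Relation.Binary.Reasoning.Setoid as ≈-Reasoning
open import Relation.Nullary.Decidable using (yes; no)
open import Relation.Nullary.Negation using (contradiction)
open import Relation.Unary using (Pred)

private
  variable
    c ℓ p : Level
    m n k : ℕ

-- Pigeonhole: if `f` missed `j`, punching `j` out of its values would inject `Fin n` into a `Fin`
-- with one element fewer.
injective⇒strictlySurjective : {f : Fin n → Fin n} →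
                               Injective _≡_ _≡_ f → StrictlySurjective _≡_ f
injective⇒strictlySurjective {n = ℕ.suc _} {f} f-inj j with any? (λ i → f i ≟ j)
... | yes preimage = preimage
... | no  ∄i       = contradiction (injective⇒≤ (f-inj ∘ punchOut-injective (j≢f _) (j≢f _))) 1+n≰n
  where
  j≢f : ∀ i → j ≢ f i
  j≢f i j≡fi = ∄i (i , ≡.sym j≡fi)

module _ {S : Setoid c ℓ} where
  open Setoid S

  HasSize⇒≤ : HasSize S n → {f : Fin m → Carrier} → Injective _≡_ _≈_ f → m ≤ n
  HasSize⇒≤ size f-inj = injective⇒≤ (f-inj ∘ from-injective)
    where
    open Inverse (Bijection⇒Inverse size)
    from-injective : Injective _≈_ _≡_ from
    from-injective {a} {b} eq =
      trans (sym (strictlyInverseˡ a)) (trans (to-cong eq) (strictlyInverseˡ b))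

  -- Choosing preimages of the enumerated elements gives an injection `section` of `Fin n` into
  -- itself, which is onto by pigeonhole. So every index is some `section j`, and `f` sends it to
  -- `to j`, which determines `j`.
  strictlySurjective⇒injective : HasSize S n → {f : Fin n → Carrier} →
                                 StrictlySurjective _≈_ f → Injective _≡_ _≈_ f
  strictlySurjective⇒injective {n = n} size {f} f-surj {i} {i′} fi≈fi′ =
    ≡.trans (≡.sym sj≡i) (≡.trans (≡.cong section j≡j′) sj′≡i′)
    where
    open Bijection size using (to; injective)
    section : Fin n → Fin n
    section j = proj₁ (f-surj (to j))

    f∘section : ∀ j → f (section j) ≈ to j
    f∘section j = proj₂ (f-surj (to j))

    section-injective : Injective _≡_ _≡_ section
    section-injective {j} {j′} eq = injective
      (trans (sym (f∘section j)) (trans (reflexive (≡.cong f eq)) (f∘section j′)))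

    section-surjective : StrictlySurjective _≡_ section
    section-surjective = injective⇒strictlySurjective section-injective

    j j′ : Fin n
    j  = proj₁ (section-surjective i)
    j′ = proj₁ (section-surjective i′)

    sj≡i : section j ≡ i
    sj≡i = proj₂ (section-surjective i)

    sj′≡i′ : section j′ ≡ i′
    sj′≡i′ = proj₂ (section-surjective i′)

    j≡j′ : j ≡ j′
    j≡j′ = injective (begin
      to j           ≈⟨ f∘section j ⟨
      f (section j)  ≡⟨ ≡.cong f sj≡i ⟩
      f i            ≈⟨ fi≈fi′ ⟩
      f i′           ≡⟨ ≡.cong f sj′≡i′ ⟨
      f (section j′) ≈⟨ f∘section j′ ⟩
      to j′          ∎)
      where open ≈-Reasoning S

module _ (G : Group c ℓ) where
  open Group G
  open GroupProperties G

  \\≈\\⇒//≈// : ∀ {a a′ b b′} → b \\ a ≈ b′ \\ a′ → a // a′ ≈ b // b′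
  \\≈\\⇒//≈// {a} {a′} {b} {b′} eq = begin
    -- Inserting `b` and its inverse to the left of `a` exposes the left quotient that `eq`
    -- replaces; afterwards `a′` cancels on the right.
    a // a′                 ≈⟨ ∙-congʳ (\\-leftDividesˡ b a) ⟨
    (b ∙ (b \\ a)) // a′    ≈⟨ ∙-congʳ (∙-congˡ eq) ⟩
    (b ∙ (b′ \\ a′)) // a′  ≈⟨ ∙-congʳ (assoc b (b′ ⁻¹) a′) ⟨
    ((b // b′) ∙ a′) // a′  ≈⟨ //-rightDividesʳ a′ (b // b′) ⟩
    b // b′                 ∎
    where open ≈-Reasoning setoid

  module _ {D : Pred (Vector Carrier n) p} {v lam : ℕ}
           (isMDS : IsMultiDifferenceSet G n v k lam D) where
    open IsMultiDifferenceSet isMDS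
    open Bijection (IsSubsetOfSize.size subset) using (to; strictlySurjective)

    tuple : Fin k → Vector Carrier n
    tuple i = proj₁ (to i)

    difference-injective : ∀ {x y} → x Fin.< y →
                           Injective _≡_ _≈_ (λ i → tuple i x // tuple i y)
    difference-injective {x} {y} x<y =
      strictlySurjective⇒injective
        {S = restrict setoid (coordinateDifferences G D x y)}
        (IsSubsetOfSize.size (IsDifferenceSet.subset (differences x y x<y)))
        {f = λ i → tuple i x // tuple i y , tuple i , proj₂ (to i) , refl}
        -- A member of the difference set brings a tuple `d` producing it. The enumeration reaches
        -- `d` only up to pointwise equality, which suffices because subtraction respects it.
        λ { (g , d , d∈D , g≈) →
            let i , tuple≋d = strictlySurjective (d , d∈D)
            in  i , trans (//-cong₂ (tuple≋d x) (tuple≋d y)) (sym g≈) }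

    -- Left quotients are the right choice when `G` is not abelian: equality of two of them becomes
    -- equality of right differences between coordinates, as in the definition. Equal right
    -- quotients would instead compare left differences of coordinates, about which nothing is
    -- assumed.
    quotient-injective : ∀ {i j} → i ≢ j →
                         Injective _≡_ _≈_ (λ x → tuple j x \\ tuple i x)
    quotient-injective i≢j {x} {y} eq with <-cmp x y
    ... | tri< x<y _ _ = contradiction (difference-injective x<y (\\≈\\⇒//≈// eq)) i≢j
    ... | tri≈ _ x≡y _ = x≡y
    -- Differences are controlled only for increasing coordinates, so the two sides are swapped.
    ... | tri> _ _ y<x = contradiction (difference-injective y<x (\\≈\\⇒//≈// (sym eq))) i≢j

theorem4p1 : ∀ {c ℓ p : Level} (G : Group c ℓ) (v : ℕ) → HasSize (Group.setoid G) v →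
    ∀ (n k lam : ℕ) → 2 ≤ k →
    (Σ[ D ∈ Pred (Vector (Group.Carrier G) n) p ] IsMultiDifferenceSet G n v k lam D) →
    n ≤ v
theorem4p1 G v order n k lam (s≤s (s≤s _)) (D , isMDS) =
  -- Matching on `2 ≤ k` exposes two successors in `k`, so `zero` and `suc zero` are distinct
  -- indices of tuples in `D`.
  HasSize⇒≤ order (quotient-injective G isMDS {zero} {suc zero} λ ())
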